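{- Let $n,k,i,j$ be integers with $1\le k\le n$, $0\le i\le k-1$ and $0\le j\le n-k$. Then the coefficient of $\alpha^{k-1-i}\beta^{i}\lambda^{n-k-j}\mu^{j}$ in the polynomial $\mathbb{S}(n,k;\alpha,\beta,\lambda,\mu)$ satisfies $$[\alpha^{k-1-i}\beta^{i}\lambda^{n-k-j}\mu^{j}]\,\mathbb{S}(n,k;\alpha,\beta,\lambda,\mu)=\left|\left\{\pi\in\mathrm{LLP}_{n,k}: \mathrm{rlb}(\pi)=k-1-i,\ \mathrm{nsb}(\pi)=i,\ \mathrm{rle}(\pi)=n-k-j,\ \mathrm{nse}(\pi)=j\right\}\right|$$ $$=\begin{bmatrix}n\\ n-j\end{bmatrix}\left\{\begin{matrix}n-j\\ k\end{matrix}\right\}\begin{bmatrix}k\\ k-i\end{bmatrix}.$$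
   Context: $\mathrm{LLP}_{n,m}$ is the set of all "list of lists" partitions of $[n]=\{1,\dots,n\}$ into $m$ blocks: ordered sequences $\pi=B_1/B_2/\cdots/B_m$ of nonempty disjoint blocks with union $[n]$, where in addition the elements inside each block are linearly ordered (each block is a word $B_\ell=\sigma_1\cdots\sigma_{n_\ell}$). For $\pi\in\mathrm{LLP}_{n,m}$ define four statistics. (1) $\mathrm{rlb}(\pi)$ is the number of indices $j$ such that $\min B_j<\min B_l$ for all $l>j$ and $\min B_j>1$. (2) $\mathrm{nsb}(\pi)$ is the number of blocks that must be moved to the right to make the sequence of block minima increasing, i.e. the number of indices $j$ for which there is $l>j$ with $\min B_l<\min B_j$; thus $\mathrm{nsb}(\pi)+\mathrm{rlb}(\pi)=m-1$. (3) For a block $B_\ell=\sigma_1\cdots\sigma_{n_\ell}$, $\mathrm{rle}(B_\ell)$ is the number of indices $j$ such that $\sigma_j<\sigma_l$ for all $l>j$ and $\sigma_j>\min B_\ell$; and $\mathrm{rle}(\pi)=\sum_{\ell}\mathrm{rle}(B_\ell)$. (4) $\mathrm{nse}(\pi)$ is the total number of elements that must be moved to the right inside their blocks to make every block increasing, i.e. the number of elements that are followed, somewhere later in the same block, by a smaller element; thus $\mathrm{nse}(\pi)+\mathrm{rle}(\pi)=n-m$. Define $$\mathbb{S}(n,m;\alpha,\beta,\lambda,\mu)=\sum_{\pi\in\mathrm{LLP}_{n,m}}\alpha^{\mathrm{rlb}(\pi)}\beta^{\mathrm{nsb}(\pi)}\lambda^{\mathrm{rle}(\pi)}\mu^{\mathrm{nse}(\pi)},$$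 a polynomial in the indeterminates $\alpha,\beta,\lambda,\mu$. $\begin{bmatrix}n\\ k\end{bmatrix}$ is the unsigned Stirling number of the first kind and $\left\{\begin{matrix}n\\ k\end{matrix}\right\}$ the Stirling number of the second kind. -}

module Defs where

open import Data.Bool.Base using (if_then_else_)
open import Data.Fin.Base using (Fin; zero; suc)
open import Data.List.Base
  using (List; []; _∷_; [_]; _++_; map; foldr; length; filter; concatMap;
         cartesianProductWith; applyUpTo; deduplicate)
import Data.List.Properties as List
open import Data.List.Membership.Propositional using (_∈_; find)
open import Data.List.Membership.Propositional.Properties
  using (∈-map⁺; ∈-map⁻; ∈-++⁺ˡ; ∈-++⁺ʳ; ∈-++⁻; ∈-concatMap⁺; ∈-concatMap⁻;
         ∈-∃++; ∈-deduplicate⁺; ∈-deduplicate⁻)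
open import Data.List.NonEmpty.Base using (List⁺; _∷_; toList; foldr₁; _∷⁺_)
open import Data.List.Relation.Binary.Permutation.Propositional
  using (_↭_; prep; swap; trans; ↭-sym; ↭-refl)
open import Data.List.Relation.Binary.Permutation.Propositional.Properties
  using (∈-resp-↭; drop-mid; ↭-empty-inv)
open import Data.List.Relation.Unary.All using (All; all?)
open import Data.List.Relation.Unary.Any using (Any; any?; here; there)
import Data.List.Relation.Unary.Any as Any
open import Data.List.Relation.Unary.Unique.Propositional using (Unique)
open import Data.List.Relation.Unary.Unique.DecPropositional.Properties using (deduplicate-!)
open import Data.Nat.Base using (ℕ; zero; suc; _+_; _*_; _⊓_)
open import Data.Nat.ListAction using (sum)
open import Data.Nat.Properties using (_≟_; _<?_)
open import Data.Product.Base using (_×_; _,_; proj₁; proj₂; ∃)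
open import Data.Sum.Base using (inj₁; inj₂)
open import Data.Vec.Base using (Vec; replicate; zipWith; _[_]≔_)
import Data.Vec.Properties as Vec
open import Relation.Binary.Definitions using (DecidableEquality)
open import Relation.Binary.PropositionalEquality using (_≡_; refl; cong; cong₂)
open import Relation.Nullary.Decidable using (Dec; does; map′; _×-dec_)
open import Relation.Unary using (Decidable)

-- Unsigned: stirling₁ n k counts the permutations of n elements with k cycles.
stirling₁ : ℕ → ℕ → ℕ
stirling₁ zero    zero    = 1
stirling₁ zero    (suc k) = 0
stirling₁ (suc n) zero    = 0
stirling₁ (suc n) (suc k) = n * stirling₁ n (suc k) + stirling₁ n k

stirling₂ : ℕ → ℕ → ℕ
stirling₂ zero    zero    = 1
stirling₂ zero    (suc k) = 0
stirling₂ (suc n) zero    = 0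
stirling₂ (suc n) (suc k) = suc k * stirling₂ n (suc k) + stirling₂ n k

-- A polynomial in α, β, λ, μ over ℕ is written as a formal sum of terms
-- (coefficient , exponents); like terms need not be collected, and it is
-- `coeff` that collects them. The indeterminate λ is spelled ƛ.
Exponents : Set
Exponents = Vec ℕ 4

Poly : Set
Poly = List (ℕ × Exponents)

infixl 6 _+ₚ_
infixl 7 _*ₚ_
infixr 8 _^ₚ_

0ₚ 1ₚ : Poly
0ₚ = []
1ₚ = [ 1 , replicate 4 0 ]

var : Fin 4 → Poly
var x = [ 1 , replicate 4 0 [ x ]≔ 1 ]

α β ƛ μ : Poly
α = var zero
β = var (suc zero)
ƛ = var (suc (suc zero))
μ = var (suc (suc (suc zero)))

_+ₚ_ : Poly → Poly → Poly
_+ₚ_ = _++_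

_*ₚ_ : Poly → Poly → Poly
_*ₚ_ = cartesianProductWith λ (c , e) (d , f) → c * d , zipWith _+_ e f

_^ₚ_ : Poly → ℕ → Poly
p ^ₚ zero  = 1ₚ
p ^ₚ suc n = p *ₚ p ^ₚ n

coeff : Exponents → Poly → ℕ
coeff e p = sum (map proj₁ (filter (λ t → Vec.≡-dec _≟_ (proj₂ t) e) p))

record Enumeration {A : Set} (P : A → Set) : Set where
  field
    elements : List A
    unique   : Unique elements
    sound    : ∀ {x} → x ∈ elements → P x
    complete : ∀ {x} → P x → x ∈ elements

open Enumeration public

∑ : {A : Set} {P : A → Set} → Enumeration P → (A → Poly) → Poly
∑ E f = foldr _+ₚ_ 0ₚ (map f (elements E))

-- The number of x satisfying both P and Q.
count : {A : Set} {P Q : A → Set} → Enumeration P → Decidable Q → ℕ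
count E Q? = length (filter Q? (elements E))

Block : Set
Block = List⁺ ℕ

entries : List Block → List ℕ
entries = concatMap toList

-- The blocks are nonempty by typing. That the entries are a rearrangement of
-- 1, …, n says that the blocks are disjoint words without repeated letters and
-- that their union is [n].
record IsLLP (n m : ℕ) (π : List Block) : Set where
  constructor mkLLP
  field
    blocks    : length π ≡ m
    partition : entries π ↭ applyUpTo suc n

-- The number of positions at which Q x ys holds, where x is the entry at that
-- position and ys is the list of all later entries.
positions : {Q : ℕ → List ℕ → Set} → (∀ x ys → Dec (Q x ys)) → List ℕ → ℕ
positions Q? []       = 0
positions Q? (x ∷ xs) = (if does (Q? x xs) then 1 else 0) + positions Q? xs

minimum : Block → ℕ
minimum = foldr₁ _⊓_

rlb : List Block → ℕ
rlb π = positions (λ b bs → all? (b <?_) bs ×-dec 1 <? b) (map minimum π)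

-- A block has to be moved to the right, in order to sort the blocks by minimum,
-- exactly when some later block has a smaller minimum; similarly for nseBlock.
nsb : List Block → ℕ
nsb π = positions (λ b bs → any? (_<? b) bs) (map minimum π)

rleBlock : Block → ℕ
rleBlock B = positions (λ σ τs → all? (σ <?_) τs ×-dec minimum B <? σ) (toList B)

rle : List Block → ℕ
rle π = sum (map rleBlock π)

nseBlock : Block → ℕ
nseBlock B = positions (λ σ τs → any? (_<? σ) τs) (toList B)

nse : List Block → ℕ
nse π = sum (map nseBlock π)

-- Candidates are obtained by cutting each permutation of 1, …, n into m words.
-- They are pairwise distinct, so deduplication removes nothing; it is there
-- because it yields the field `unique` directly.

inserts : ℕ → List ℕ → List (List ℕ)
inserts x []       = [ [ x ] ]
inserts x (y ∷ ys) = (x ∷ y ∷ ys) ∷ map (y ∷_) (inserts x ys)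

permutations : List ℕ → List (List ℕ)
permutations []       = [ [] ]
permutations (x ∷ xs) = concatMap (inserts x) (permutations xs)

extendFirst : ℕ → List Block → List (List Block)
extendFirst x []      = []
extendFirst x (B ∷ π) = [ (x ∷⁺ B) ∷ π ]

cuts : ℕ → List ℕ → List (List Block)
cuts zero    []       = [ [] ]
cuts zero    (x ∷ xs) = []
cuts (suc m) []       = []
cuts (suc m) (x ∷ xs) = map ((x ∷ []) ∷_) (cuts m xs) ++ concatMap (extendFirst x) (cuts (suc m) xs)

candidates : ℕ → ℕ → List (List Block)
candidates n m = concatMap (cuts m) (permutations (applyUpTo suc n))

_≟ᴮ_ : DecidableEquality Block
(x ∷ xs) ≟ᴮ (y ∷ ys) =
  map′ (λ (p , q) → cong₂ _∷_ p q) (λ { refl → refl , refl }) (x ≟ y ×-dec List.≡-dec _≟_ xs ys)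

_≟ᴾ_ : DecidableEquality (List Block)
_≟ᴾ_ = List.≡-dec _≟ᴮ_

private
  ∈-concatMap-intro : ∀ {A B : Set} (f : A → List B) {x y xs} →
                      x ∈ xs → y ∈ f x → y ∈ concatMap f xs
  ∈-concatMap-intro f x∈ y∈ = ∈-concatMap⁺ f (Any.map (λ { refl → y∈ }) x∈)

  ∈-concatMap-elim : ∀ {A B : Set} (f : A → List B) {y} xs →
                     y ∈ concatMap f xs → ∃ λ x → x ∈ xs × y ∈ f x
  ∈-concatMap-elim f xs y∈ = find (∈-concatMap⁻ f {xs = xs} y∈)

  inserts-sound : ∀ x ys {zs} → zs ∈ inserts x ys → zs ↭ x ∷ ys
  inserts-sound x []       (here refl) = ↭-refl
  inserts-sound x (y ∷ ys) (here refl) = ↭-refl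
  inserts-sound x (y ∷ ys) (there p) with ∈-map⁻ (y ∷_) p
  ... | ws , q , refl = trans (prep y (inserts-sound x ys q)) (swap y x ↭-refl)

  inserts-complete : ∀ x ys zs → ys ++ x ∷ zs ∈ inserts x (ys ++ zs)
  inserts-complete x []       []       = here refl
  inserts-complete x []       (z ∷ zs) = here refl
  inserts-complete x (y ∷ ys) zs       = there (∈-map⁺ (y ∷_) (inserts-complete x ys zs))

  permutations-sound : ∀ xs {zs} → zs ∈ permutations xs → zs ↭ xs
  permutations-sound []       (here refl) = ↭-refl
  permutations-sound (x ∷ xs) p with ∈-concatMap-elim (inserts x) (permutations xs) p
  ... | ys , q , r = trans (inserts-sound x ys r) (prep x (permutations-sound xs q))

  permutations-complete : ∀ xs {zs} → zs ↭ xs → zs ∈ permutations xs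
  permutations-complete []       p = here (↭-empty-inv p)
  permutations-complete (x ∷ xs) p with ∈-∃++ (∈-resp-↭ (↭-sym p) (here refl))
  ... | ys , zs , refl =
    ∈-concatMap-intro (inserts x) (permutations-complete xs (drop-mid ys [] p)) (inserts-complete x ys zs)

  cuts-sound : ∀ m xs {π} → π ∈ cuts m xs → length π ≡ m × entries π ≡ xs
  cuts-sound zero    []       (here refl) = refl , refl
  cuts-sound (suc m) (x ∷ xs) p with ∈-++⁻ (map ((x ∷ []) ∷_) (cuts m xs)) p
  ... | inj₁ q with ∈-map⁻ ((x ∷ []) ∷_) q
  ...   | ρ , r , refl = let a , b = cuts-sound m xs r in cong suc a , cong (x ∷_) b
  cuts-sound (suc m) (x ∷ xs) p | inj₂ q with ∈-concatMap-elim (extendFirst x) (cuts (suc m) xs) q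
  ...   | B ∷ ρ , r , here refl = let a , b = cuts-sound (suc m) xs r in a , cong (x ∷_) b

  cuts-complete : ∀ π → π ∈ cuts (length π) (entries π)
  cuts-complete []            = here refl
  cuts-complete ((x ∷ B) ∷ π) = block x B
    where
    block : ∀ x B → (x ∷ B) ∷ π ∈ cuts (suc (length π)) (x ∷ B ++ entries π)
    block x []      = ∈-++⁺ˡ (∈-map⁺ ((x ∷ []) ∷_) (cuts-complete π))
    block x (y ∷ B) = ∈-++⁺ʳ (map ((x ∷ []) ∷_) (cuts (length π) (y ∷ B ++ entries π)))
                        (∈-concatMap-intro (extendFirst x) (block y B) (here refl))

LLP : ∀ n m → Enumeration (IsLLP n m)
LLP n m .elements = deduplicate _≟ᴾ_ (candidates n m)
LLP n m .unique   = deduplicate-! _≟ᴾ_ (candidates n m)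
LLP n m .sound p
  with ∈-concatMap-elim (cuts m) (permutations (applyUpTo suc n)) (∈-deduplicate⁻ _≟ᴾ_ (candidates n m) p)
... | w , q , r with cuts-sound m w r
...   | a , refl = mkLLP a (permutations-sound (applyUpTo suc n) q)
LLP n m .complete {π} (mkLLP refl p) =
  ∈-deduplicate⁺ _≟ᴾ_
    (∈-concatMap-intro (cuts (length π)) (permutations-complete (applyUpTo suc n) p) (cuts-complete π))

𝕊 : ℕ → ℕ → Poly
𝕊 n m = ∑ (LLP n m) λ π → α ^ₚ rlb π *ₚ β ^ₚ nsb π *ₚ ƛ ^ₚ rle π *ₚ μ ^ₚ nse π

{-# OPTIONS --safe #-}
module Submission where

-- Build the partitions of [n+1] into k+1 blocks by inserting the largest letter n+1, which never
-- changes the minimum of an existing block. As a singleton block it raises rlb when placed last and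
-- nsb at the k other places (n ≥ 1); inside a block it raises rle at the end of the word (k+1 places) and
-- nse in front of any of the n letters. Hence
--   𝕊(n+1,k+1) = (α + kβ) 𝕊(n,k) + ((k+1)λ + nμ) 𝕊(n,k+1),
-- and expanding the three Stirling numbers by their own recurrences shows that their product obeys
-- the same one.

open import Defs
open import Algebra.Properties.CommutativeSemigroup using (x∙yz≈y∙xz)
open import Data.Bool.Base using (true; false; _∧_; if_then_else_)
open import Data.List.Base
  using (List; []; _∷_; [_]; _++_; map; length; filter; concatMap; applyUpTo)
open import Data.List.Membership.Propositional using (_∈_; _∉_; find; lose)
open import Data.List.Membership.Propositional.Properties
  using (∈-map⁺; ∈-map⁻; ∈-++⁺ˡ; ∈-++⁺ʳ; ∈-++⁻; ∈-concatMap⁺; ∈-concatMap⁻; ∈-applyUpTo⁻)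
open import Data.List.Membership.Propositional.Properties.WithK using (unique∧set⇒bag)
open import Data.List.NonEmpty.Base using (_∷_; toList)
open import Data.List.Properties
  using (map-∘; map-++; map-cong-local; map-injective; filter-all; filter-reject; filter-accept;
         ∷-injectiveˡ; ∷-injectiveʳ; length-applyUpTo; applyUpTo-∷ʳ; length-map; length-++)
open import Data.List.Relation.Binary.BagAndSetEquality using (∼bag⇒↭)
open import Data.List.Relation.Binary.Disjoint.Propositional using (Disjoint)
open import Data.List.Relation.Binary.Permutation.Propositional
  using (_↭_; prep; swap; trans; ↭-sym; ↭-refl; ↭-reflexive)
open import Data.List.Relation.Binary.Permutation.Propositional.Properties
  using (∈-resp-↭; All-resp-↭; Any-resp-↭; drop-∷; shift; ++⁺ˡ; ++⁺ʳ; ∷↭∷ʳ; ↭-length)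
  renaming (map⁺ to ↭-map⁺)
open import Data.List.Relation.Unary.All as All using (All; []; _∷_; all?)
open import Data.List.Relation.Unary.All.Properties using (++⁻ˡ; ++⁻ʳ)
open import Data.List.Relation.Unary.Any using (Any; any?; here; there)
open import Data.List.Relation.Unary.AllPairs using ([]; _∷_)
open import Data.List.Relation.Unary.Unique.Propositional using (Unique)
import Data.List.Relation.Unary.Unique.Propositional.Properties as Unique
open import Data.Nat using (ℕ; zero; suc; _≤_; _<_; _∸_; _+_; _*_; _⊓_; s≤s; z≤n)
open import Data.Nat.ListAction using (sum)
open import Data.Nat.ListAction.Properties using (sum-++; sum-↭)
open import Data.Nat.Properties
  using (_≟_; _<?_; suc-injective; ≤-refl; ≤-reflexive; ≤-trans; <⇒≤; <-asym; <-irrefl; ≤-<-trans;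
         m<n⇒m<1+n; m⊓n≤m; m≤n⇒m⊓n≡m; m≥n⇒m⊓n≡n; *-zeroʳ; *-identityˡ; +-suc; +-assoc; +-identityʳ;
         +-commutativeSemigroup; +-∸-assoc; m∸n+n≡m; m+n∸n≡m; m+[n∸m]≡n)
open import Data.Nat.Tactic.RingSolver using (solve-∀)
open import Data.Product using (_×_; _,_; ∃; ∃-syntax)
open import Data.Sum using (_⊎_; inj₁; inj₂)
open import Data.Vec using ([]; _∷_)
import Data.Vec.Properties as Vec
open import Function using (_∘_; _∘′_; mk⇔)
open import Relation.Binary.Definitions using (DecidableEquality)
open import Relation.Binary.PropositionalEquality
  using (_≡_; _≢_; refl; sym; cong; cong₂; subst; module ≡-Reasoning)
  renaming (trans to ≡-trans)
open import Relation.Nullary.Decidable using (Dec; does; _×-dec_; ¬?; dec-false; dec-true; does-⇔)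
open import Relation.Nullary.Negation using (contradiction)
open import Relation.Unary using (Decidable)

-- Insertion into a list and its inverse.

private variable
  A B : Set

-- Polymorphic, unlike `inserts`, because it serves for letters in a word, singleton blocks in a
-- partition and values in the list of block minima.
insertions : A → List A → List (List A)
insertions x []       = [ [ x ] ]
insertions x (y ∷ ys) = (x ∷ y ∷ ys) ∷ map (y ∷_) (insertions x ys)

insertions-↭ : ∀ {x : A} ys {zs} → zs ∈ insertions x ys → zs ↭ x ∷ ys
insertions-↭ []       (here refl) = ↭-refl
insertions-↭ (y ∷ ys) (here refl) = ↭-refl
insertions-↭ (y ∷ ys) (there p) with ∈-map⁻ (y ∷_) p
... | _ , q , refl = trans (prep y (insertions-↭ ys q)) (swap y _ ↭-refl)

-- Inserting at the front gives a list headed by `x`; every other insertion keeps the old head `y`,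
-- which differs from `x` by freshness.
insertions-unique : ∀ {x : A} {ys} → x ∉ ys → Unique (insertions x ys)
insertions-unique {ys = []}     x∉ = [] ∷ []
insertions-unique {ys = y ∷ ys} x∉ =
  All.tabulate front ∷ Unique.map⁺ ∷-injectiveʳ (insertions-unique (x∉ ∘′ there))
  where
  front : ∀ {zs} → zs ∈ map (y ∷_) (insertions _ ys) → _ ≢ zs
  front p eq with ∈-map⁻ (y ∷_) p
  ... | _ , _ , refl = x∉ (here (∷-injectiveˡ eq))

module _ (_≈?_ : DecidableEquality A) where

  remove : A → List A → List A
  remove x = filter (λ y → ¬? (y ≈? x))

  remove-∉ : ∀ {x ys} → x ∉ ys → remove x ys ≡ ys
  remove-∉ x∉ = filter-all _ (All.tabulate λ y∈ → λ { refl → x∉ y∈ })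

  remove-here : ∀ x ys → remove x (x ∷ ys) ≡ remove x ys
  remove-here x ys = filter-reject (λ y → ¬? (y ≈? x)) (λ x≢x → x≢x refl)

  -- Provides the injectivity of insertion: `ys` can be read off from any of its insertions.
  -- Freshness matters because `remove` deletes every copy of `x`.
  remove-insertions : ∀ {x} ys {zs} → x ∉ ys → zs ∈ insertions x ys → remove x zs ≡ ys
  remove-insertions []           x∉ (here refl) = remove-here _ []
  remove-insertions ys@(_ ∷ _)   x∉ (here refl) = ≡-trans (remove-here _ ys) (remove-∉ x∉)
  remove-insertions {x} (y ∷ ys) x∉ (there p) with ∈-map⁻ (y ∷_) p
  ... | _ , q , refl =
    ≡-trans (filter-accept (λ z → ¬? (z ≈? x)) λ { refl → x∉ (here refl) })
            (cong (y ∷_) (remove-insertions ys (x∉ ∘′ there) q))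

∈⇒insertions : ∀ {x : A} {zs} → x ∈ zs → ∃[ ys ] zs ∈ insertions x ys
∈⇒insertions {zs = _ ∷ []}     (here refl) = [] , here refl
∈⇒insertions {zs = _ ∷ z ∷ zs} (here refl) = z ∷ zs , here refl
∈⇒insertions {zs = z ∷ _}      (there p) with ∈⇒insertions p
... | ys , q = z ∷ ys , there (∈-map⁺ (z ∷_) q)

-- With `f` the block minimum, inserting a singleton block becomes inserting its letter into the
-- list of minima.
map-insertions : ∀ (f : A → B) x ys → map (map f) (insertions x ys) ≡ insertions (f x) (map f ys)
map-insertions f x []       = refl
map-insertions f x (y ∷ ys) = cong ((f x ∷ f y ∷ map f ys) ∷_) (begin
  map (map f) (map (y ∷_) (insertions x ys)) ≡⟨ map-∘ (insertions x ys) ⟨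
  map (λ zs → f y ∷ map f zs) (insertions x ys) ≡⟨ map-∘ (insertions x ys) ⟩
  map (f y ∷_) (map (map f) (insertions x ys)) ≡⟨ cong (map (f y ∷_)) (map-insertions f x ys) ⟩
  map (f y ∷_) (insertions (f x) (map f ys)) ∎)
  where open ≡-Reasoning

-- Sums over lists.

total : (A → ℕ) → List A → ℕ
total f xs = sum (map f xs)

total-++ : ∀ (f : A → ℕ) xs ys → total f (xs ++ ys) ≡ total f xs + total f ys
total-++ f xs ys = ≡-trans (cong sum (map-++ f xs ys)) (sum-++ (map f xs) (map f ys))

total-map : ∀ (f : B → ℕ) (g : A → B) xs → total f (map g xs) ≡ total (f ∘ g) xs
total-map f g xs = cong sum (sym (map-∘ xs))

total-cong : ∀ {f g : A → ℕ} xs → (∀ {x} → x ∈ xs → f x ≡ g x) → total f xs ≡ total g xs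
total-cong xs f≗g = cong sum (map-cong-local (All.tabulate f≗g))

total-↭ : ∀ (f : A → ℕ) {xs ys} → xs ↭ ys → total f xs ≡ total f ys
total-↭ f xs↭ys = sum-↭ (↭-map⁺ f xs↭ys)

-- Sums a local insertion count over all smaller partitions; `p` and `q` are numbers of places,
-- which are the same for every partition.
total-concatMap : ∀ (f : B → ℕ) (g : A → List B) (u v : A → ℕ) p q xs →
  (∀ {x} → x ∈ xs → total f (g x) ≡ p * u x + q * v x) →
  total f (concatMap g xs) ≡ p * total u xs + q * total v xs
total-concatMap f g u v p q []       _ rewrite *-zeroʳ p | *-zeroʳ q = refl
total-concatMap f g u v p q (x ∷ xs) h = begin
  total f (g x ++ concatMap g xs)                              ≡⟨ total-++ f (g x) _ ⟩
  total f (g x) + total f (concatMap g xs)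
    ≡⟨ cong₂ _+_ (h (here refl)) (total-concatMap f g u v p q xs (h ∘′ there)) ⟩
  (p * u x + q * v x) + (p * total u xs + q * total v xs)       ≡⟨ regroup p q (u x) (v x) _ _ ⟩
  p * (u x + total u xs) + q * (v x + total v xs)               ∎
  where
  open ≡-Reasoning
  regroup : ∀ p q a b c d → (p * a + q * b) + (p * c + q * d) ≡ p * (a + c) + q * (b + d)
  regroup = solve-∀

-- Indicators, and right-to-left minima of words.

indicator : ∀ {P : Set} → Dec P → ℕ
indicator P? = if does P? then 1 else 0

length-filter : ∀ {P : A → Set} (P? : Decidable P) xs →
  length (filter P? xs) ≡ total (λ x → indicator (P? x)) xs
length-filter P? []       = refl
length-filter P? (x ∷ xs) with does (P? x)
... | true  = cong suc (length-filter P? xs)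
... | false = length-filter P? xs

-- Right-to-left minima exceeding the threshold m, so that rlb and rleBlock are the cases m = 1
-- and m = min B.
rlMinima : ℕ → List ℕ → ℕ
rlMinima m = positions λ x ys → all? (x <?_) ys ×-dec m <? x

nonMinima : List ℕ → ℕ
nonMinima = positions λ x ys → any? (_<? x) ys

-- At the end of the word `x` is a new right-to-left minimum above `m`; at each of the other
-- `length ys` places a smaller letter follows it. Being larger than all letters, `x` never changes
-- the status of another one. The arbitrary `φ` records the joint distribution of both statistics.
total-insertions : ∀ {x m} ys → All (_< x) ys → m < x → (φ : ℕ → ℕ → ℕ) →
  total (λ zs → φ (rlMinima m zs) (nonMinima zs)) (insertions x ys)
    ≡ φ (suc (rlMinima m ys)) (nonMinima ys) + length ys * φ (rlMinima m ys) (suc (nonMinima ys))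
total-insertions {x} {m} [] [] m<x φ
  rewrite dec-true (m <? x) m<x = refl
total-insertions {x} {m} (y ∷ ys) (y<x ∷ ys<x) m<x φ = begin
  φ (rlMinima m (x ∷ y ∷ ys)) (nonMinima (x ∷ y ∷ ys)) + total weight (map (y ∷_) (insertions x ys))
    ≡⟨ cong₂ _+_ front (begin
         total weight (map (y ∷_) (insertions x ys)) ≡⟨ total-map weight (y ∷_) (insertions x ys) ⟩
         total (weight ∘ (y ∷_)) (insertions x ys)
           ≡⟨ total-cong (insertions x ys) later ⟩
         total (λ zs → φ (r + rlMinima m zs) (s + nonMinima zs)) (insertions x ys)
           -- The head `y` contributes the constants `r` and `s`, which are absorbed into `φ`; the
           -- induction therefore needs `φ` to vary.
           ≡⟨ total-insertions ys ys<x m<x (λ p q → φ (r + p) (s + q)) ⟩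
         φ (r + suc (rlMinima m ys)) (s + nonMinima ys)
           + length ys * φ (r + rlMinima m ys) (s + suc (nonMinima ys))
           ≡⟨ cong₂ (λ p q → φ p (s + nonMinima ys) + length ys * φ (r + rlMinima m ys) q)
                (+-suc r _) (+-suc s _) ⟩
         φ (suc (r + rlMinima m ys)) (s + nonMinima ys)
           + length ys * φ (r + rlMinima m ys) (suc (s + nonMinima ys)) ∎) ⟩
  φ (rlMinima m (y ∷ ys)) (suc (nonMinima (y ∷ ys)))
    + (φ (suc (rlMinima m (y ∷ ys))) (nonMinima (y ∷ ys))
       + length ys * φ (rlMinima m (y ∷ ys)) (suc (nonMinima (y ∷ ys))))
    ≡⟨ x∙yz≈y∙xz +-commutativeSemigroup (φ (rlMinima m (y ∷ ys)) (suc (nonMinima (y ∷ ys))))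
         (φ (suc (rlMinima m (y ∷ ys))) (nonMinima (y ∷ ys))) _ ⟩
  φ (suc (rlMinima m (y ∷ ys))) (nonMinima (y ∷ ys))
    + suc (length ys) * φ (rlMinima m (y ∷ ys)) (suc (nonMinima (y ∷ ys))) ∎
  where
  open ≡-Reasoning

  weight : List ℕ → ℕ
  weight zs = φ (rlMinima m zs) (nonMinima zs)

  r s : ℕ
  r = indicator (all? (y <?_) ys ×-dec m <? y)
  s = indicator (any? (_<? y) ys)

  front : weight (x ∷ y ∷ ys) ≡ φ (rlMinima m (y ∷ ys)) (suc (nonMinima (y ∷ ys)))
  front rewrite dec-false (x <? y) (<-asym y<x) | dec-true (y <? x) y<x = refl

  -- Up to order `zs` is `x ∷ ys`, and since `y < x` the additional letter affects neither test on
  -- `y`.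
  later : ∀ {zs} → zs ∈ insertions x ys →
    weight (y ∷ zs) ≡ φ (r + rlMinima m zs) (s + nonMinima zs)
  later {zs} zs∈ = cong₂ φ
    (cong (λ b → (if b ∧ does (m <? y) then 1 else 0) + rlMinima m zs)
      (does-⇔ (mk⇔ (λ p → All.tail (All-resp-↭ perm p)) (λ p → All-resp-↭ (↭-sym perm) (y<x ∷ p)))
        (all? (y <?_) zs) (all? (y <?_) ys)))
    (cong (λ b → (if b then 1 else 0) + nonMinima zs)
      (does-⇔ (mk⇔ (λ p → strip (Any-resp-↭ perm p)) (λ p → Any-resp-↭ (↭-sym perm) (there p)))
        (any? (_<? y) zs) (any? (_<? y) ys)))
    where
    perm = insertions-↭ ys zs∈
    strip : Any (_< y) (x ∷ ys) → Any (_< y) ys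
    strip (here x<y) = contradiction x<y (<-asym y<x)
    strip (there p)  = p

-- Inserting the largest letter into an existing block.

insertBlock : ℕ → Block → List Block
insertBlock x (y ∷ ys) = (x ∷ y ∷ ys) ∷ map (y ∷_) (insertions x ys)

insertLetter : ℕ → List Block → List (List Block)
insertLetter x []      = []
insertLetter x (B ∷ π) = map (_∷ π) (insertBlock x B) ++ map (B ∷_) (insertLetter x π)

-- Carries the facts about insertion into words over to blocks, whose type enforces nonemptiness.
map-toList-insertBlock : ∀ x B → map toList (insertBlock x B) ≡ insertions x (toList B)
map-toList-insertBlock x (y ∷ ys) = cong ((x ∷ y ∷ ys) ∷_) (sym (map-∘ (insertions x ys)))

toList-∈-insertions : ∀ {x B C} → C ∈ insertBlock x B → toList C ∈ insertions x (toList B)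
toList-∈-insertions {x} {B} {C} C∈ = subst (toList C ∈_) (map-toList-insertBlock x B) (∈-map⁺ toList C∈)

minimum≤head : ∀ y ys → minimum (y ∷ ys) ≤ y
minimum≤head y []       = ≤-refl
minimum≤head y (z ∷ zs) = m⊓n≤m y _

-- The larger letter `x` is absorbed by the minimum of what follows it or, at the end, by the letter
-- before it. The head `y` is kept apart to match the recursion of `foldr₁`.
minimum-insertions : ∀ {x} y ys {zs} → y < x → All (_< x) ys → zs ∈ insertions x ys →
  minimum (y ∷ zs) ≡ minimum (y ∷ ys)
minimum-insertions y []       y<x _ (here refl) = m≤n⇒m⊓n≡m (<⇒≤ y<x)
minimum-insertions y (z ∷ zs) y<x (z<x ∷ _) (here refl) =
  cong (y ⊓_) (m≥n⇒m⊓n≡n (≤-trans (minimum≤head z zs) (<⇒≤ z<x)))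
minimum-insertions y (z ∷ zs) y<x (z<x ∷ zs<x) (there p) with ∈-map⁻ (z ∷_) p
... | _ , q , refl = cong (y ⊓_) (minimum-insertions z zs z<x zs<x q)

minimum-insertBlock : ∀ {x} B {C} → All (_< x) (toList B) → C ∈ insertBlock x B →
  minimum C ≡ minimum B
minimum-insertBlock (y ∷ ys) (y<x ∷ _) (here refl) =
  m≥n⇒m⊓n≡n (≤-trans (minimum≤head y ys) (<⇒≤ y<x))
minimum-insertBlock (y ∷ ys) (y<x ∷ ys<x) (there p) with ∈-map⁻ (y ∷_) p
... | _ , q , refl = minimum-insertions y ys y<x ys<x q

minimum< : ∀ {x} B → All (_< x) (toList B) → minimum B < x
minimum< (y ∷ ys) (y<x ∷ _) = ≤-<-trans (minimum≤head y ys) y<x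

minima< : ∀ {x} π → All (_< x) (entries π) → All (_< x) (map minimum π)
minima< []      _  = []
minima< (B ∷ π) <x = minimum< B (++⁻ˡ (toList B) <x) ∷ minima< π (++⁻ʳ (toList B) <x)

minima-insertLetter : ∀ {x} ρ {π} → All (_< x) (entries ρ) → π ∈ insertLetter x ρ →
  map minimum π ≡ map minimum ρ
minima-insertLetter {x} (B ∷ ρ) <x π∈ with ∈-++⁻ (map (_∷ ρ) (insertBlock x B)) π∈
... | inj₁ p with ∈-map⁻ (_∷ ρ) p
...   | _ , q , refl = cong (_∷ map minimum ρ) (minimum-insertBlock B (++⁻ˡ (toList B) <x) q)
minima-insertLetter {x} (B ∷ ρ) <x π∈ | inj₂ p with ∈-map⁻ (B ∷_) p
...   | _ , q , refl = cong (minimum B ∷_) (minima-insertLetter ρ (++⁻ʳ (toList B) <x) q)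

-- Each block has one place at its end, where `rle` grows, and each letter has one place in front of
-- it, where `nse` grows.
total-insertLetter : ∀ {x} ρ → All (_< x) (entries ρ) → (φ : ℕ → ℕ → ℕ) →
  total (λ π → φ (rle π) (nse π)) (insertLetter x ρ)
    ≡ length ρ * φ (suc (rle ρ)) (nse ρ) + length (entries ρ) * φ (rle ρ) (suc (nse ρ))
total-insertLetter         []      _  φ = refl
total-insertLetter {x} (B ∷ ρ) <x φ = begin
  total weight (map (_∷ ρ) (insertBlock x B) ++ map (B ∷_) (insertLetter x ρ))
    ≡⟨ total-++ weight (map (_∷ ρ) (insertBlock x B)) _ ⟩
  total weight (map (_∷ ρ) (insertBlock x B)) + total weight (map (B ∷_) (insertLetter x ρ))
    ≡⟨ cong₂ _+_ first rest ⟩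
  (φ (suc (rle (B ∷ ρ))) (nse (B ∷ ρ)) + length (toList B) * φ (rle (B ∷ ρ)) (suc (nse (B ∷ ρ))))
    + (length ρ * φ (suc (rle (B ∷ ρ))) (nse (B ∷ ρ))
       + length (entries ρ) * φ (rle (B ∷ ρ)) (suc (nse (B ∷ ρ))))
    ≡⟨ regroup (φ (suc (rle (B ∷ ρ))) (nse (B ∷ ρ))) (φ (rle (B ∷ ρ)) (suc (nse (B ∷ ρ))))
         (length (toList B)) (length ρ) (length (entries ρ)) ⟩
  suc (length ρ) * φ (suc (rle (B ∷ ρ))) (nse (B ∷ ρ))
    + (length (toList B) + length (entries ρ)) * φ (rle (B ∷ ρ)) (suc (nse (B ∷ ρ)))
    ≡⟨ cong (λ l → suc (length ρ) * φ (suc (rle (B ∷ ρ))) (nse (B ∷ ρ))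
                   + l * φ (rle (B ∷ ρ)) (suc (nse (B ∷ ρ)))) (length-++ (toList B)) ⟨
  suc (length ρ) * φ (suc (rle (B ∷ ρ))) (nse (B ∷ ρ))
    + length (entries (B ∷ ρ)) * φ (rle (B ∷ ρ)) (suc (nse (B ∷ ρ))) ∎
  where
  open ≡-Reasoning
  weight : List Block → ℕ
  weight π = φ (rle π) (nse π)

  blockWeight : List ℕ → ℕ
  blockWeight w = φ (rlMinima (minimum B) w + rle ρ) (nonMinima w + nse ρ)

  regroup : ∀ u v b k l → (u + b * v) + (k * u + l * v) ≡ (u + k * u) + (b + l) * v
  regroup = solve-∀

  first : total weight (map (_∷ ρ) (insertBlock x B))
    ≡ φ (suc (rle (B ∷ ρ))) (nse (B ∷ ρ)) + length (toList B) * φ (rle (B ∷ ρ)) (suc (nse (B ∷ ρ)))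
  first = begin
    total weight (map (_∷ ρ) (insertBlock x B)) ≡⟨ total-map weight (_∷ ρ) (insertBlock x B) ⟩
    total (λ C → weight (C ∷ ρ)) (insertBlock x B)
      -- The threshold in `rleBlock C` depends on `C`; it is first fixed at the unchanged minimum of
      -- `B`, so that the count for words applies.
      ≡⟨ total-cong (insertBlock x B) (λ {C} C∈ →
           cong (λ m → φ (rlMinima m (toList C) + rle ρ) (nseBlock C + nse ρ))
             (minimum-insertBlock B (++⁻ˡ (toList B) <x) C∈)) ⟩
    total (blockWeight ∘ toList) (insertBlock x B) ≡⟨ total-map blockWeight toList (insertBlock x B) ⟨
    total blockWeight (map toList (insertBlock x B))
      ≡⟨ cong (total blockWeight) (map-toList-insertBlock x B) ⟩
    total blockWeight (insertions x (toList B))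
      ≡⟨ total-insertions (toList B) (++⁻ˡ (toList B) <x) (minimum< B (++⁻ˡ (toList B) <x))
           (λ p q → φ (p + rle ρ) (q + nse ρ)) ⟩
    φ (suc (rle (B ∷ ρ))) (nse (B ∷ ρ))
      + length (toList B) * φ (rle (B ∷ ρ)) (suc (nse (B ∷ ρ))) ∎

  rest : total weight (map (B ∷_) (insertLetter x ρ))
    ≡ length ρ * φ (suc (rle (B ∷ ρ))) (nse (B ∷ ρ))
      + length (entries ρ) * φ (rle (B ∷ ρ)) (suc (nse (B ∷ ρ)))
  rest = begin
    total weight (map (B ∷_) (insertLetter x ρ)) ≡⟨ total-map weight (B ∷_) (insertLetter x ρ) ⟩
    total (λ π → φ (rleBlock B + rle π) (nseBlock B + nse π)) (insertLetter x ρ)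
      ≡⟨ total-insertLetter ρ (++⁻ʳ (toList B) <x) (λ p q → φ (rleBlock B + p) (nseBlock B + q)) ⟩
    length ρ * φ (rleBlock B + suc (rle ρ)) (nse (B ∷ ρ))
      + length (entries ρ) * φ (rle (B ∷ ρ)) (nseBlock B + suc (nse ρ))
      ≡⟨ cong₂ (λ p q → length ρ * φ p (nse (B ∷ ρ)) + length (entries ρ) * φ (rle (B ∷ ρ)) q)
           (+-suc (rleBlock B) (rle ρ)) (+-suc (nseBlock B) (nse ρ)) ⟩
    length ρ * φ (suc (rle (B ∷ ρ))) (nse (B ∷ ρ))
      + length (entries ρ) * φ (rle (B ∷ ρ)) (suc (nse (B ∷ ρ))) ∎

-- Entries and distinctness of the enlarged partitions.

entries-insertions : ∀ {x} ρ {π} → π ∈ insertions (x ∷ []) ρ → entries π ↭ x ∷ entries ρ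
entries-insertions []          (here refl) = ↭-refl
entries-insertions (B ∷ ρ)     (here refl) = ↭-refl
entries-insertions {x} (B ∷ ρ) (there p) with ∈-map⁻ (B ∷_) p
... | _ , q , refl =
  trans (++⁺ˡ (toList B) (entries-insertions ρ q)) (shift x (toList B) (entries ρ))

entries-insertLetter : ∀ {x} ρ {π} → π ∈ insertLetter x ρ → entries π ↭ x ∷ entries ρ
entries-insertLetter {x} (B ∷ ρ) π∈ with ∈-++⁻ (map (_∷ ρ) (insertBlock x B)) π∈
... | inj₁ p with ∈-map⁻ (_∷ ρ) p
...   | _ , q , refl = ++⁺ʳ (entries ρ) (insertions-↭ (toList B) (toList-∈-insertions q))
entries-insertLetter {x} (B ∷ ρ) π∈ | inj₂ p with ∈-map⁻ (B ∷_) p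
...   | _ , q , refl =
  trans (++⁺ˡ (toList B) (entries-insertLetter ρ q)) (shift x (toList B) (entries ρ))

length-insertLetter : ∀ {x} ρ {π} → π ∈ insertLetter x ρ → length π ≡ length ρ
length-insertLetter {x} (B ∷ ρ) π∈ with ∈-++⁻ (map (_∷ ρ) (insertBlock x B)) π∈
... | inj₁ p with ∈-map⁻ (_∷ ρ) p
...   | _ , _ , refl = refl
length-insertLetter {x} (B ∷ ρ) π∈ | inj₂ p with ∈-map⁻ (B ∷_) p
...   | _ , q , refl = cong suc (length-insertLetter ρ q)

toList-injective : ∀ {B C : Block} → toList B ≡ toList C → B ≡ C
toList-injective {_ ∷ _} {_ ∷ _} refl = refl

insertBlock-unique : ∀ {x} B → x ∉ toList B → Unique (insertBlock x B)
insertBlock-unique {x} B x∉ =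
  Unique.map⁻ (subst Unique (sym (map-toList-insertBlock x B)) (insertions-unique x∉))

insertLetter-unique : ∀ {x} ρ → x ∉ entries ρ → Unique (insertLetter x ρ)
insertLetter-unique         []      x∉ = []
insertLetter-unique {x} (B ∷ ρ) x∉ =
  Unique.++⁺ (Unique.map⁺ ∷-injectiveˡ (insertBlock-unique B (x∉ ∘′ ∈-++⁺ˡ)))
             (Unique.map⁺ ∷-injectiveʳ (insertLetter-unique ρ (x∉ ∘′ ∈-++⁺ʳ (toList B))))
             λ (p , q) → disjoint p q
  where
  disjoint : ∀ {π} → π ∈ map (_∷ ρ) (insertBlock x B) → π ∉ map (B ∷_) (insertLetter x ρ)
  disjoint p q with ∈-map⁻ (_∷ ρ) p | ∈-map⁻ (B ∷_) q
  -- The first block would be both `B` itself and `B` with `x` inserted, which would put `x` into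
  -- `B`.
  ... | _ , r , refl | _ , _ , refl =
    x∉ (∈-++⁺ˡ (∈-resp-↭ (↭-sym (insertions-↭ (toList B) (toList-∈-insertions r))) (here refl)))

-- The values are words rather than blocks, since deleting `x` from a singleton block leaves an
-- empty word.
erase : ℕ → List Block → List (List ℕ)
erase x = map (remove _≟_ x ∘ toList)

erase-∉ : ∀ {x} ρ → x ∉ entries ρ → erase x ρ ≡ map toList ρ
erase-∉ []      x∉ = refl
erase-∉ (B ∷ ρ) x∉ =
  cong₂ _∷_ (remove-∉ _≟_ (x∉ ∘′ ∈-++⁺ˡ)) (erase-∉ ρ (x∉ ∘′ ∈-++⁺ʳ (toList B)))

-- Shows that the partition before the insertion is determined by the result, and that no block
-- becomes empty when `x` is deleted again.
erase-insertLetter : ∀ {x} ρ {π} → x ∉ entries ρ → π ∈ insertLetter x ρ →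
  erase x π ≡ map toList ρ
erase-insertLetter {x} (B ∷ ρ) x∉ π∈ with ∈-++⁻ (map (_∷ ρ) (insertBlock x B)) π∈
... | inj₁ p with ∈-map⁻ (_∷ ρ) p
...   | _ , q , refl =
  cong₂ _∷_ (remove-insertions _≟_ (toList B) (x∉ ∘′ ∈-++⁺ˡ) (toList-∈-insertions q))
            (erase-∉ ρ (x∉ ∘′ ∈-++⁺ʳ (toList B)))
erase-insertLetter {x} (B ∷ ρ) x∉ π∈ | inj₂ p with ∈-map⁻ (B ∷_) p
...   | _ , q , refl =
  cong₂ _∷_ (remove-∉ _≟_ (x∉ ∘′ ∈-++⁺ˡ)) (erase-insertLetter ρ (x∉ ∘′ ∈-++⁺ʳ (toList B)) q)

-- Listing the partitions recursively by the place of the largest letter.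

∈-block⇒∈-entries : ∀ {x B} {π : List Block} → x ∈ toList B → B ∈ π → x ∈ entries π
∈-block⇒∈-entries x∈B B∈π = ∈-concatMap⁺ toList (lose B∈π x∈B)

∈-concatMap-elim : ∀ (f : A → List B) {y} xs → y ∈ concatMap f xs → ∃ λ x → x ∈ xs × y ∈ f x
∈-concatMap-elim f xs y∈ = find (∈-concatMap⁻ f {xs = xs} y∈)

∈-concatMap-intro : ∀ (f : A → List B) {x y xs} → x ∈ xs → y ∈ f x → y ∈ concatMap f xs
∈-concatMap-intro f x∈ y∈ = ∈-concatMap⁺ f (lose x∈ y∈)

concatMap-unique : ∀ (f : A → List B) {xs} → Unique xs → (∀ {x} → x ∈ xs → Unique (f x)) →
  (∀ {x y z} → x ∈ xs → y ∈ xs → z ∈ f x → z ∈ f y → x ≡ y) → Unique (concatMap f xs)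
concatMap-unique f {[]}     _           _  _   = []
concatMap-unique f {x ∷ xs} (x≢ ∷ xs!) f! inj =
  Unique.++⁺ (f! (here refl))
    (concatMap-unique f xs! (f! ∘′ there) λ p q → inj (there p) (there q))
    disjoint
  where
  disjoint : Disjoint (f x) (concatMap f xs)
  disjoint (p , q) with ∈-concatMap-elim f xs q
  ... | y , y∈ , r = All.lookup x≢ y∈ (inj (here refl) (there y∈) p r)

-- A second enumeration of the same partitions, shaped like the recurrence: the largest letter is a
-- block by itself in the first part and shares its block in the second.
llps : ℕ → ℕ → List (List Block)
llps zero    zero    = [ [] ]
llps zero    (suc k) = []
llps (suc n) zero    = []
llps (suc n) (suc k) =
  concatMap (insertions (suc n ∷ [])) (llps n k) ++ concatMap (insertLetter (suc n)) (llps n (suc k))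


suc∷applyUpTo : ∀ n → suc n ∷ applyUpTo suc n ↭ applyUpTo suc (suc n)
suc∷applyUpTo n = trans (∷↭∷ʳ (suc n) _) (↭-reflexive (applyUpTo-∷ʳ suc n))

llps-sound : ∀ n k {π} → π ∈ llps n k → IsLLP n k π
llps-sound zero    zero    (here refl) = mkLLP refl ↭-refl
llps-sound (suc n) (suc k) π∈ with ∈-++⁻ (concatMap (insertions (suc n ∷ [])) (llps n k)) π∈
... | inj₁ p with ∈-concatMap-elim (insertions (suc n ∷ [])) (llps n k) p
...   | ρ , ρ∈ , q with llps-sound n k ρ∈
...     | mkLLP l e = mkLLP (≡-trans (↭-length (insertions-↭ ρ q)) (cong suc l))
                            (trans (entries-insertions ρ q) (trans (prep _ e) (suc∷applyUpTo n)))
llps-sound (suc n) (suc k) π∈ | inj₂ p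
  with ∈-concatMap-elim (insertLetter (suc n)) (llps n (suc k)) p
...   | ρ , ρ∈ , q with llps-sound n (suc k) ρ∈
...     | mkLLP l e = mkLLP (≡-trans (length-insertLetter ρ q) l)
                            (trans (entries-insertLetter ρ q) (trans (prep _ e) (suc∷applyUpTo n)))

-- The witness `ρ` is `π` with an occurrence of `x` deleted. If `x` stood alone, its block
-- disappears; otherwise the block stays nonempty.
∈⇒inserted : ∀ {x} π → x ∈ entries π →
  (∃[ ρ ] π ∈ insertions (x ∷ []) ρ) ⊎ (∃[ ρ ] π ∈ insertLetter x ρ)
∈⇒inserted (B ∷ π) x∈ with ∈-++⁻ (toList B) x∈
∈⇒inserted ((y ∷ []) ∷ π) x∈ | inj₁ (here refl) = inj₁ (∈⇒insertions (here refl))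
∈⇒inserted ((y ∷ z ∷ zs) ∷ π) x∈ | inj₁ (here refl) = inj₂ ((z ∷ zs) ∷ π , here refl)
∈⇒inserted ((y ∷ ys) ∷ π) x∈ | inj₁ (there p) with ∈⇒insertions p
... | ws , q = inj₂ ((y ∷ ws) ∷ π , ∈-++⁺ˡ (∈-map⁺ (_∷ π) (there (∈-map⁺ (y ∷_) q))))
∈⇒inserted (B ∷ π) x∈ | inj₂ p with ∈⇒inserted π p
... | inj₁ (ρ , q) = inj₁ (B ∷ ρ , there (∈-map⁺ (B ∷_) q))
... | inj₂ (ρ , q) = inj₂ (B ∷ ρ , ∈-++⁺ʳ (map (_∷ ρ) (insertBlock _ B)) (∈-map⁺ (B ∷_) q))

-- Induction by deleting the largest letter; cancelling it on both sides of the permutation leaves a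
-- partition of the smaller set.
llps-complete : ∀ n k {π} → IsLLP n k π → π ∈ llps n k
llps-complete zero zero {[]} _ = here refl
llps-complete zero (suc k) {(x ∷ xs) ∷ π} (mkLLP _ e) = contradiction (↭-length e) λ ()
llps-complete (suc n) zero {[]} (mkLLP _ e) = contradiction (↭-length e) λ ()
llps-complete (suc n) (suc k) {π} (mkLLP l e)
  with ∈⇒inserted π (∈-resp-↭ (trans (suc∷applyUpTo n) (↭-sym e)) (here refl))
... | inj₁ (ρ , q) =
  ∈-++⁺ˡ (∈-concatMap-intro (insertions (suc n ∷ [])) {x = ρ} (llps-complete n k (mkLLP
    (suc-injective (≡-trans (sym (↭-length (insertions-↭ ρ q))) l))
    (drop-∷ (trans (↭-sym (entries-insertions ρ q)) (trans e (↭-sym (suc∷applyUpTo n))))))) q)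
... | inj₂ (ρ , q) =
  ∈-++⁺ʳ (concatMap (insertions (suc n ∷ [])) (llps n k))
    (∈-concatMap-intro (insertLetter (suc n)) {x = ρ} (llps-complete n (suc k) (mkLLP
      (≡-trans (sym (length-insertLetter ρ q)) l)
      (drop-∷ (trans (↭-sym (entries-insertLetter ρ q)) (trans e (↭-sym (suc∷applyUpTo n))))))) q)

LLP-entries< : ∀ {n k ρ} → IsLLP n k ρ → All (_< suc n) (entries ρ)
LLP-entries< {n} (mkLLP _ e) = All.tabulate λ x∈ → bound (∈-applyUpTo⁻ suc (∈-resp-↭ e x∈))
  where
  bound : ∀ {x} → (∃ λ i → i < n × x ≡ suc i) → x < suc n
  bound (_ , i<n , refl) = s≤s i<n

LLP-fresh : ∀ {n k ρ} → IsLLP n k ρ → suc n ∉ entries ρ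
LLP-fresh isLLP x∈ = <-irrefl refl (All.lookup (LLP-entries< isLLP) x∈)

-- Within each part, deleting the largest letter recovers the smaller partition: `remove` discards
-- the singleton block, `erase` the letter inside a block.
llps-unique : ∀ n k → Unique (llps n k)
llps-unique zero    zero    = [] ∷ []
llps-unique zero    (suc k) = []
llps-unique (suc n) zero    = []
llps-unique (suc n) (suc k) =
  Unique.++⁺
    (concatMap-unique (insertions (x ∷ [])) (llps-unique n k) (insertions-unique ∘′ fresh-block)
      λ {ρ} {σ} ρ∈ σ∈ p q → ≡-trans
        (sym (remove-insertions _≟ᴮ_ ρ (fresh-block ρ∈) p))
        (remove-insertions _≟ᴮ_ σ (fresh-block σ∈) q))
    (concatMap-unique (insertLetter x) (llps-unique n (suc k))
      (λ {ρ} ρ∈ → insertLetter-unique ρ (fresh ρ∈))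
      λ {ρ} {σ} {π} ρ∈ σ∈ p q → map-injective toList-injective (≡-trans
        (sym (erase-insertLetter ρ (fresh ρ∈) p))
        (erase-insertLetter σ (fresh σ∈) q)))
    λ (p , q) → disjoint p q
  where
  x = suc n

  fresh : ∀ {k ρ} → ρ ∈ llps n k → x ∉ entries ρ
  fresh ρ∈ = LLP-fresh (llps-sound n _ ρ∈)

  fresh-block : ∀ {ρ} → ρ ∈ llps n k → (x ∷ []) ∉ ρ
  fresh-block ρ∈ = fresh ρ∈ ∘′ ∈-block⇒∈-entries (here refl)

  -- Erasing x leaves an empty word exactly when x formed a block of its own.
  disjoint : ∀ {π} → π ∈ concatMap (insertions (x ∷ [])) (llps n k) →
    π ∉ concatMap (insertLetter x) (llps n (suc k))
  disjoint {π} p q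
    with ∈-concatMap-elim (insertions (x ∷ [])) (llps n k) p
       | ∈-concatMap-elim (insertLetter x) (llps n (suc k)) q
  ... | ρ , ρ∈ , r | σ , σ∈ , s = no-empty σ (subst ([] ∈_) (erase-insertLetter σ (fresh σ∈) s)
          (subst (_∈ erase x π) (remove-here _≟_ x [])
            (∈-map⁺ (remove _≟_ x ∘ toList) (∈-resp-↭ (↭-sym (insertions-↭ ρ r)) (here refl)))))
    where
    no-empty : ∀ (σ : List Block) → [] ∉ map toList σ
    no-empty (_ ∷ σ) (there p) = no-empty σ p

llps-↭-LLP : ∀ n k → llps n k ↭ elements (LLP n k)
llps-↭-LLP n k = ∼bag⇒↭ (unique∧set⇒bag (llps-unique n k) (unique (LLP n k))
  (mk⇔ (complete (LLP n k) ∘′ llps-sound n k) (llps-complete n k ∘′ sound (LLP n k))))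

-- Weighted totals and their recurrence.

Weight : Set
Weight = ℕ → ℕ → ℕ → ℕ → ℕ

-- Evaluates on the monomial of `π` the linear functional with values `φ` on exponents. Multiplying
-- by an indeterminate becomes shifting an argument of `φ`.
weigh : Weight → List Block → ℕ
weigh φ π = φ (rlb π) (nsb π) (rle π) (nse π)

rleBlock-singleton : ∀ x → rleBlock (x ∷ []) ≡ 0
rleBlock-singleton x rewrite dec-false (x <? x) (<-irrefl refl) = refl

-- A singleton block adds nothing to `rle` or `nse`. The other two statistics depend only on the
-- list of minima, into which `x` enters as a new maximum above the threshold 1.
total-newBlock : ∀ {x} ρ → All (_< x) (entries ρ) → 1 < x → (φ : Weight) →
  total (weigh φ) (insertions (x ∷ []) ρ)
    ≡ φ (suc (rlb ρ)) (nsb ρ) (rle ρ) (nse ρ) + length ρ * φ (rlb ρ) (suc (nsb ρ)) (rle ρ) (nse ρ)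
total-newBlock {x} ρ <x 1<x φ = begin
  total (weigh φ) (insertions (x ∷ []) ρ)
    ≡⟨ total-cong (insertions (x ∷ []) ρ) (λ π∈ → cong₂ (φ _ _) (rle-new π∈) (nse-new π∈)) ⟩
  total (minimaWeight ∘ map minimum) (insertions (x ∷ []) ρ)
    ≡⟨ total-map minimaWeight (map minimum) (insertions (x ∷ []) ρ) ⟨
  total minimaWeight (map (map minimum) (insertions (x ∷ []) ρ))
    ≡⟨ cong (total minimaWeight) (map-insertions minimum (x ∷ []) ρ) ⟩
  total minimaWeight (insertions x (map minimum ρ))
    ≡⟨ total-insertions (map minimum ρ) (minima< ρ <x) 1<x (λ a b → φ a b (rle ρ) (nse ρ)) ⟩
  φ (suc (rlb ρ)) (nsb ρ) (rle ρ) (nse ρ)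
    + length (map minimum ρ) * φ (rlb ρ) (suc (nsb ρ)) (rle ρ) (nse ρ)
    ≡⟨ cong (λ l → φ (suc (rlb ρ)) (nsb ρ) (rle ρ) (nse ρ) + l * φ (rlb ρ) (suc (nsb ρ)) (rle ρ) (nse ρ))
         (length-map minimum ρ) ⟩
  φ (suc (rlb ρ)) (nsb ρ) (rle ρ) (nse ρ) + length ρ * φ (rlb ρ) (suc (nsb ρ)) (rle ρ) (nse ρ) ∎
  where
  open ≡-Reasoning
  minimaWeight : List ℕ → ℕ
  minimaWeight ms = φ (rlMinima 1 ms) (nonMinima ms) (rle ρ) (nse ρ)

  rle-new : ∀ {π} → π ∈ insertions (x ∷ []) ρ → rle π ≡ rle ρ
  rle-new π∈ = ≡-trans (total-↭ rleBlock (insertions-↭ ρ π∈)) (cong (_+ rle ρ) (rleBlock-singleton x))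

  nse-new : ∀ {π} → π ∈ insertions (x ∷ []) ρ → nse π ≡ nse ρ
  nse-new π∈ = total-↭ nseBlock (insertions-↭ ρ π∈)

-- The block minima are unchanged, hence so are `rlb` and `nsb`.
total-newLetter : ∀ {x} ρ → All (_< x) (entries ρ) → (φ : Weight) →
  total (weigh φ) (insertLetter x ρ)
    ≡ length ρ * φ (rlb ρ) (nsb ρ) (suc (rle ρ)) (nse ρ)
      + length (entries ρ) * φ (rlb ρ) (nsb ρ) (rle ρ) (suc (nse ρ))
total-newLetter {x} ρ <x φ = ≡-trans
  (total-cong (insertLetter x ρ) λ {π} π∈ →
    cong (λ ms → φ (rlMinima 1 ms) (nonMinima ms) (rle π) (nse π)) (minima-insertLetter ρ <x π∈))
  (total-insertLetter ρ <x (φ (rlb ρ) (nsb ρ)))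

grandTotal : ℕ → ℕ → Weight → ℕ
grandTotal n k φ = total (weigh φ) (llps n k)

-- 𝕊(n+1,k+1) = (α + kβ) 𝕊(n,k) + ((k+1)λ + nμ) 𝕊(n,k+1), paired with the linear functional taking
-- α^a β^b λ^c μ^d to φ a b c d; it needs n ≥ 1 because rlb does not count the minimum 1.
grandTotal-suc : ∀ n k φ → let n′ = suc n in
  grandTotal (suc n′) (suc k) φ
    ≡ grandTotal n′ k (λ a b c d → φ (suc a) b c d)
      + k * grandTotal n′ k (λ a b c d → φ a (suc b) c d)
      + (suc k * grandTotal n′ (suc k) (λ a b c d → φ a b (suc c) d)
         + n′ * grandTotal n′ (suc k) (λ a b c d → φ a b c (suc d)))
grandTotal-suc n k φ = begin
  total (weigh φ) (concatMap (insertions (x ∷ [])) (llps n′ k)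
                   ++ concatMap (insertLetter x) (llps n′ (suc k)))
    ≡⟨ total-++ (weigh φ) (concatMap (insertions (x ∷ [])) (llps n′ k)) _ ⟩
  total (weigh φ) (concatMap (insertions (x ∷ [])) (llps n′ k))
    + total (weigh φ) (concatMap (insertLetter x) (llps n′ (suc k)))
    ≡⟨ cong₂ _+_
         (total-concatMap (weigh φ) (insertions (x ∷ [])) (weigh φα) (weigh φβ) 1 k (llps n′ k) newBlock)
         (total-concatMap (weigh φ) (insertLetter x) (weigh φλ) (weigh φμ) (suc k) n′
            (llps n′ (suc k)) newLetter) ⟩
  1 * grandTotal n′ k φα + k * grandTotal n′ k φβ
    + (suc k * grandTotal n′ (suc k) φλ + n′ * grandTotal n′ (suc k) φμ)
    ≡⟨ cong (λ t → t + k * grandTotal n′ k φβ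
                 + (suc k * grandTotal n′ (suc k) φλ + n′ * grandTotal n′ (suc k) φμ))
         (*-identityˡ (grandTotal n′ k φα)) ⟩
  grandTotal n′ k φα + k * grandTotal n′ k φβ
    + (suc k * grandTotal n′ (suc k) φλ + n′ * grandTotal n′ (suc k) φμ) ∎
  where
  open ≡-Reasoning
  n′ x : ℕ
  n′ = suc n
  x  = suc n′

  φα φβ φλ φμ : Weight
  φα a b c d = φ (suc a) b c d
  φβ a b c d = φ a (suc b) c d
  φλ a b c d = φ a b (suc c) d
  φμ a b c d = φ a b c (suc d)

  newBlock : ∀ {ρ} → ρ ∈ llps n′ k →
    total (weigh φ) (insertions (x ∷ []) ρ) ≡ 1 * weigh φα ρ + k * weigh φβ ρ
  newBlock {ρ} ρ∈ with llps-sound n′ k ρ∈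
  ... | isLLP@(mkLLP refl _) = ≡-trans
    (total-newBlock ρ (LLP-entries< isLLP) (s≤s (s≤s z≤n)) φ)
    (cong (_+ length ρ * weigh φβ ρ) (sym (*-identityˡ (weigh φα ρ))))

  newLetter : ∀ {ρ} → ρ ∈ llps n′ (suc k) →
    total (weigh φ) (insertLetter x ρ) ≡ suc k * weigh φλ ρ + n′ * weigh φμ ρ
  newLetter {ρ} ρ∈ with llps-sound n′ (suc k) ρ∈
  ... | isLLP@(mkLLP l e) = ≡-trans
    (total-newLetter ρ (LLP-entries< isLLP) φ)
    (cong₂ (λ p q → p * weigh φλ ρ + q * weigh φμ ρ) l
      (≡-trans (↭-length e) (length-applyUpTo suc n′)))

-- Coefficients as products of Stirling numbers.

total-zero : ∀ {f : A → ℕ} xs → (∀ x → f x ≡ 0) → total f xs ≡ 0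
total-zero []       _   = refl
total-zero (x ∷ xs) f≗0 = cong₂ _+_ (f≗0 x) (total-zero xs f≗0)

stirling₁-zero : ∀ {n k} → n < k → stirling₁ n k ≡ 0
stirling₁-zero {zero}  {suc k} _ = refl
stirling₁-zero {suc n} {suc k} (s≤s n<k)
  rewrite stirling₁-zero n<k | stirling₁-zero (m<n⇒m<1+n n<k) = cong (_+ 0) (*-zeroʳ n)

stirling₂-zero : ∀ {n k} → n < k → stirling₂ n k ≡ 0
stirling₂-zero {zero}  {suc k} _ = refl
stirling₂-zero {suc n} {suc k} (s≤s n<k)
  rewrite stirling₂-zero n<k | stirling₂-zero (m<n⇒m<1+n n<k) = cong (_+ 0) (*-zeroʳ (suc k))

-- Nested exactly as the counting predicate of the theorem, so that the two agree by definition.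
matches? : ∀ a b c d p q r s → Dec (p ≡ a × q ≡ b × r ≡ c × s ≡ d)
matches? a b c d p q r s = (p ≟ a) ×-dec (q ≟ b) ×-dec (r ≟ c) ×-dec (s ≟ d)

δ : ℕ → ℕ → ℕ → ℕ → Weight
δ a b c d p q r s = indicator (matches? a b c d p q r s)

coefficient : ℕ → ℕ → ℕ → ℕ → ℕ → ℕ → ℕ
coefficient n k a b c d = grandTotal n k (δ a b c d)

-- r = n - j counts the right-to-left minima inside blocks, and m = k - i those among the minima of
-- the blocks.
closedForm : ℕ → ℕ → ℕ → ℕ → ℕ
closedForm n r k m = stirling₁ n r * stirling₂ r k * stirling₁ k m

-- Taking the exponents as parameters avoids truncated subtraction. Each term of the recurrence
-- lowers one exponent, so the induction hypothesis applies unless that exponent is zero.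
coefficient-formula : ∀ n a b c d → a + b + c + d ≡ n →
  coefficient (suc n) (suc (a + b)) a b c d
    ≡ closedForm (suc n) (suc (a + b + c)) (suc (a + b)) (suc a)
-- The one-letter case is computed directly, as the recurrence starts at two letters.
coefficient-formula zero    zero zero zero zero refl = refl
coefficient-formula (suc n) a    b    c    d    eq   = begin
  coefficient (suc n′) (suc k) a b c d
    ≡⟨ grandTotal-suc n k (δ a b c d) ⟩
  grandTotal n′ k (λ p q r s → δ a b c d (suc p) q r s)
    + k * grandTotal n′ k (λ p q r s → δ a b c d p (suc q) r s)
    + (suc k * grandTotal n′ (suc k) (λ p q r s → δ a b c d p q (suc r) s)
       + n′ * grandTotal n′ (suc k) (λ p q r s → δ a b c d p q r (suc s)))
    ≡⟨ cong₂ _+_ (cong₂ _+_ (α-term a b c eq) (cong (k *_) (β-term a b c eq)))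
         (cong₂ _+_ (cong (suc k *_) (λ-term a b c eq)) (cong (n′ *_) (μ-term d eq))) ⟩
  closedForm n′ l k a + k * closedForm n′ l k (suc a)
    + (suc k * closedForm n′ l (suc k) (suc a) + n′ * closedForm n′ (suc l) (suc k) (suc a))
    ≡⟨ expand n′ k (stirling₁ n′ l) (stirling₁ n′ (suc l)) (stirling₂ l k) (stirling₂ l (suc k))
         (stirling₁ k a) (stirling₁ k (suc a)) ⟩
  closedForm (suc n′) (suc l) (suc k) (suc a) ∎
  where
  open ≡-Reasoning
  n′ k l : ℕ
  n′ = suc n
  k  = a + b
  l  = a + b + c

  -- `s`, `t`, `u` stand for `stirling₁ n′ l`, `stirling₂ l k`, `stirling₁ k a`, and a prime raises
  -- the lower index by one. The right side is the product of the three Stirling recurrences.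
  expand : ∀ n k s s′ t t′ u u′ →
    s * t * u + k * (s * t * u′)
      + (suc k * (s * t′ * (k * u′ + u)) + n * (s′ * (suc k * t′ + t) * (k * u′ + u)))
      ≡ (n * s′ + s) * (suc k * t′ + t) * (k * u′ + u)
  expand = solve-∀

  α-term : ∀ a b c → a + b + c + d ≡ n′ →
    grandTotal n′ (a + b) (λ p q r s → δ a b c d (suc p) q r s)
      ≡ closedForm n′ (a + b + c) (a + b) a
  α-term zero b c _ = ≡-trans (total-zero (llps n′ b) λ _ → refl) (sym (vanish b c))
    where
    -- `stirling₁ b 0` vanishes unless `b` is zero; then `stirling₂ c 0` vanishes unless `c` is
    -- zero; then `stirling₁ n′ 0` vanishes because `n′` is positive.
    vanish : ∀ b c → closedForm n′ (b + c) b 0 ≡ 0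
    vanish zero    zero    = refl
    vanish zero    (suc c) = cong (_* 1) (*-zeroʳ (stirling₁ n′ (suc c)))
    vanish (suc b) c       = *-zeroʳ (stirling₁ n′ (suc b + c) * stirling₂ (suc b + c) (suc b))
  α-term (suc a) b c eq = coefficient-formula n a b c d (suc-injective eq)

  -- In the boundary cases of this and the next two terms, the lower index of one Stirling factor
  -- exceeds its upper index by one: `stirling₁ k (suc k)` for β, `stirling₂ k (suc k)` for λ,
  -- `stirling₁ n′ (suc n′)` for μ.
  β-term : ∀ a b c → a + b + c + d ≡ n′ →
    grandTotal n′ (a + b) (λ p q r s → δ a b c d p (suc q) r s)
      ≡ closedForm n′ (a + b + c) (a + b) (suc a)
  β-term a zero c _ = ≡-trans
    (total-zero (llps n′ (a + 0)) λ π → δ-zero (does (rlb π ≟ a)))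
    (sym (≡-trans (cong (stirling₁ n′ (a + 0 + c) * stirling₂ (a + 0 + c) (a + 0) *_)
                        (stirling₁-zero (s≤s (≤-reflexive (+-identityʳ a)))))
                  (*-zeroʳ (stirling₁ n′ (a + 0 + c) * stirling₂ (a + 0 + c) (a + 0)))))
    where
    δ-zero : ∀ u → (if u ∧ false then 1 else 0) ≡ 0
    δ-zero false = refl
    δ-zero true  = refl
  β-term a (suc b) c eq rewrite +-suc a b = coefficient-formula n a b c d (suc-injective eq)

  λ-term : ∀ a b c → a + b + c + d ≡ n′ →
    grandTotal n′ (suc (a + b)) (λ p q r s → δ a b c d p q (suc r) s)
      ≡ closedForm n′ (a + b + c) (suc (a + b)) (suc a)
  λ-term a b zero _ = ≡-trans
    (total-zero (llps n′ (suc (a + b))) λ π → δ-zero (does (rlb π ≟ a)) (does (nsb π ≟ b)))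
    (sym (cong (_* stirling₁ (suc (a + b)) (suc a))
      (≡-trans (cong (stirling₁ n′ (a + b + 0) *_)
                     (stirling₂-zero (s≤s (≤-reflexive (+-identityʳ (a + b))))))
               (*-zeroʳ (stirling₁ n′ (a + b + 0))))))
    where
    δ-zero : ∀ u v → (if u ∧ v ∧ false then 1 else 0) ≡ 0
    δ-zero false _     = refl
    δ-zero true  false = refl
    δ-zero true  true  = refl
  λ-term a b (suc c) eq rewrite +-suc (a + b) c = coefficient-formula n a b c d (suc-injective eq)

  μ-term : ∀ d → l + d ≡ n′ →
    grandTotal n′ (suc k) (λ p q r s → δ a b c d p q r (suc s))
      ≡ closedForm n′ (suc l) (suc k) (suc a)
  μ-term zero eq = ≡-trans
    (total-zero (llps n′ (suc k)) λ π →
      δ-zero (does (rlb π ≟ a)) (does (nsb π ≟ b)) (does (rle π ≟ c)))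
    (sym (cong (λ t → t * stirling₂ (suc l) (suc k) * stirling₁ (suc k) (suc a))
      (stirling₁-zero (s≤s (≤-reflexive (≡-trans (sym eq) (+-identityʳ l)))))))
    where
    δ-zero : ∀ u v w → (if u ∧ v ∧ w ∧ false then 1 else 0) ≡ 0
    δ-zero false _     _     = refl
    δ-zero true  false _     = refl
    δ-zero true  true  false = refl
    δ-zero true  true  true  = refl
  μ-term (suc d) eq =
    coefficient-formula n a b c d (suc-injective (≡-trans (sym (+-suc l d)) eq))

-- Reading coefficients off the formal sum.

α-power : ∀ n → α ^ₚ n ≡ [ 1 , n ∷ 0 ∷ 0 ∷ 0 ∷ [] ]
α-power zero = refl
α-power (suc n) rewrite α-power n = refl

β-power : ∀ n → β ^ₚ n ≡ [ 1 , 0 ∷ n ∷ 0 ∷ 0 ∷ [] ]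
β-power zero = refl
β-power (suc n) rewrite β-power n = refl

ƛ-power : ∀ n → ƛ ^ₚ n ≡ [ 1 , 0 ∷ 0 ∷ n ∷ 0 ∷ [] ]
ƛ-power zero = refl
ƛ-power (suc n) rewrite ƛ-power n = refl

μ-power : ∀ n → μ ^ₚ n ≡ [ 1 , 0 ∷ 0 ∷ 0 ∷ n ∷ [] ]
μ-power zero = refl
μ-power (suc n) rewrite μ-power n = refl

monomial : ∀ a b c d → α ^ₚ a *ₚ β ^ₚ b *ₚ ƛ ^ₚ c *ₚ μ ^ₚ d ≡ [ 1 , a ∷ b ∷ c ∷ d ∷ [] ]
monomial a b c d
  rewrite α-power a | β-power b | ƛ-power c | μ-power d
        -- Every later factor adds a zero to an exponent: three for `a`, two for `b`, one for `c`.
        | +-identityʳ a | +-identityʳ a | +-identityʳ a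
        | +-identityʳ b | +-identityʳ b | +-identityʳ c = refl

coeff-∷ : ∀ e c f p → coeff e ((c , f) ∷ p) ≡ (if does (Vec.≡-dec _≟_ f e) then c else 0) + coeff e p
coeff-∷ e c f p with does (Vec.≡-dec _≟_ f e)
... | true  = refl
... | false = refl

-- Each partition contributes a single term with coefficient 1, so collecting like terms counts the
-- partitions with the given exponents.
coeff-∑ : ∀ {P : List Block → Set} (E : Enumeration P) a b c d →
  coeff (a ∷ b ∷ c ∷ d ∷ []) (∑ E λ π → α ^ₚ rlb π *ₚ β ^ₚ nsb π *ₚ ƛ ^ₚ rle π *ₚ μ ^ₚ nse π)
    ≡ total (weigh (δ a b c d)) (elements E)
coeff-∑ E a b c d = go (elements E)
  where
  e = a ∷ b ∷ c ∷ d ∷ []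

  term : List Block → Poly
  term π = α ^ₚ rlb π *ₚ β ^ₚ nsb π *ₚ ƛ ^ₚ rle π *ₚ μ ^ₚ nse π

  exponents : List Block → Exponents
  exponents π = rlb π ∷ nsb π ∷ rle π ∷ nse π ∷ []

  go : ∀ πs → coeff e (concatMap term πs) ≡ total (weigh (δ a b c d)) πs
  go []       = refl
  go (π ∷ πs) = begin
    coeff e (term π ++ concatMap term πs)
      ≡⟨ cong (λ t → coeff e (t ++ concatMap term πs)) (monomial (rlb π) (nsb π) (rle π) (nse π)) ⟩
    coeff e ((1 , exponents π) ∷ concatMap term πs)
      ≡⟨ coeff-∷ e 1 (exponents π) (concatMap term πs) ⟩
    indicator (Vec.≡-dec _≟_ (exponents π) e) + coeff e (concatMap term πs)
      ≡⟨ cong₂ (λ u v → (if u then 1 else 0) + v)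
           (does-⇔ (mk⇔ (λ { refl → refl , refl , refl , refl }) λ { (refl , refl , refl , refl) → refl })
             (Vec.≡-dec _≟_ (exponents π) e) (matches? a b c d (rlb π) (nsb π) (rle π) (nse π)))
           (go πs) ⟩
    total (weigh (δ a b c d)) (π ∷ πs) ∎
    where open ≡-Reasoning

theorem4p3 : (n k i j : ℕ) → 1 ≤ k → k ≤ n → i ≤ k ∸ 1 → j ≤ n ∸ k →
    let N = count (LLP n k) (λ π → (rlb π ≟ k ∸ 1 ∸ i) ×-dec (nsb π ≟ i) ×-dec (rle π ≟ n ∸ k ∸ j) ×-dec (nse π ≟ j))
    in (coeff (k ∸ 1 ∸ i ∷ i ∷ n ∸ k ∸ j ∷ j ∷ []) (𝕊 n k) ≡ N)
    × (N ≡ stirling₁ n (n ∸ j) * stirling₂ (n ∸ j) k * stirling₁ k (k ∸ i))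
theorem4p3 (suc n) (suc k) i j _ (s≤s k≤n) i≤k j≤n∸k =
  ≡-trans (coeff-∑ (LLP (suc n) (suc k)) a i c j) (sym N≡total) , (begin
    count (LLP (suc n) (suc k)) (λ π → matches? a i c j (rlb π) (nsb π) (rle π) (nse π)) ≡⟨ N≡total ⟩
    total (weigh (δ a i c j)) (elements (LLP (suc n) (suc k)))
      -- A total is independent of the order of listing, so the recursive enumeration may replace
      -- the given one.
      ≡⟨ total-↭ (weigh (δ a i c j)) (llps-↭-LLP (suc n) (suc k)) ⟨
    coefficient (suc n) (suc k) a i c j
      ≡⟨ cong (λ m → coefficient (suc n) (suc m) a i c j) a+i≡k ⟨
    coefficient (suc n) (suc (a + i)) a i c j
      ≡⟨ coefficient-formula n a i c j a+i+c+j≡n ⟩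
    closedForm (suc n) (suc (a + i + c)) (suc (a + i)) (suc a)
      ≡⟨ cong₂ (λ m r → stirling₁ (suc n) r * stirling₂ r (suc m) * stirling₁ (suc m) (suc a))
           a+i≡k n∸j ⟩
    closedForm (suc n) (suc n ∸ j) (suc k) (suc a)
      ≡⟨ cong (closedForm (suc n) (suc n ∸ j) (suc k)) (+-∸-assoc 1 i≤k) ⟨
    closedForm (suc n) (suc n ∸ j) (suc k) (suc k ∸ i) ∎)
  where
  open ≡-Reasoning
  -- With these values `a + i + c + j` equals `n`, and the bounds on `i`, `j` and `k` make every
  -- truncated subtraction exact.
  a c : ℕ
  a = k ∸ i
  c = n ∸ k ∸ j

  N≡total : count (LLP (suc n) (suc k)) (λ π → matches? a i c j (rlb π) (nsb π) (rle π) (nse π))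
    ≡ total (weigh (δ a i c j)) (elements (LLP (suc n) (suc k)))
  N≡total = length-filter _ (elements (LLP (suc n) (suc k)))

  a+i≡k : a + i ≡ k
  a+i≡k = m∸n+n≡m i≤k

  a+i+c+j≡n : a + i + c + j ≡ n
  a+i+c+j≡n = begin
    a + i + c + j   ≡⟨ +-assoc (a + i) c j ⟩
    a + i + (c + j) ≡⟨ cong₂ _+_ a+i≡k (m∸n+n≡m j≤n∸k) ⟩
    k + (n ∸ k)     ≡⟨ m+[n∸m]≡n k≤n ⟩
    n               ∎

  n∸j : suc (a + i + c) ≡ suc n ∸ j
  n∸j = begin
    suc (a + i + c)         ≡⟨ m+n∸n≡m (suc (a + i + c)) j ⟨
    suc (a + i + c) + j ∸ j ≡⟨ cong (λ m → suc m ∸ j) a+i+c+j≡n ⟩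
    suc n ∸ j               ∎
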